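{- Let $M=(s_0,S,R,L)$ be a Kripke structure and $\eta$ a CTL formula. If $M$ is repairable with respect to $\eta$, then the algorithm $\textsc{Repair}(M,\eta)$ returns a Kripke structure $M''$ such that $M''$ is total, $M''\subseteq M$, and $M'',s_0\models\eta$.
   Context: Let $\mathcal{AP}$ be a set of atomic propositions, including the constants $\mathsf{true}$ and $\mathsf{false}$, which are always interpreted as $\mathit{tt}$ and $\mathit{ff}$ (so $\mathsf{true}\in L(s)$ and $\mathsf{false}\notin L(s)$ for every state $s$). A Kripke structure is a tuple $M=(s_0,S,R,L)$ with $S$ a finite set of states, $s_0\in S$ initial, $R\subseteq S\times S$, $L:S\to2^{\mathcal{AP}}$. It is total if every state has an outgoing transition; the input $M$ is assumed total. Write $s\to t$ for $(s,t)\in R$. A fullpath is an infinite sequence of states consecutive under $R$. Substructure: $M'=(s_0',S',R',L')\subseteq M=(s_0,S,R,L)$ means $S'\subseteq S$, $s_0'=s_0$, $R'\subseteq R$, $L'=L\upharpoonright S'$. $M$ is repairable with respect to $\eta$ if there is a total Kripke structure $M'\subseteq M$ with $M',s_0\models\eta$. CTL: $\varphi ::= \mathsf{true}\mid\mathsf{false}\mid p\mid\neg\varphi\mid\varphi\land\varphi\mid\varphi\lor\varphi\mid \mathsf{AX}\varphi\mid\mathsf{EX}\varphi\mid\mathsf{A}[\varphi\,\mathsf{V}\,\varphi]\mid\mathsf{E}[\varphi\,\mathsf{V}\,\varphi]$, $p\in\mathcal{AP}$. Semantics: $M,s\models p$ iff $p\in L(s)$; constants and boolean connectives as usual; $M,s\models\mathsf{AX}\varphi$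 (resp. $\mathsf{EX}\varphi$) iff $M,t\models\varphi$ for all (resp. some) $t$ with $s\to t$; $M,s\models\mathsf{A}[\varphi\,\mathsf{V}\,\psi]$ (resp. $\mathsf{E}[\varphi\,\mathsf{V}\,\psi]$) iff for all (resp. some) fullpaths $s=s_0,s_1,\dots$ from $s$: for all $k\ge0$, if $M,s_j\not\models\varphi$ for all $j<k$ then $M,s_k\models\psi$. $\mathit{sub}(\varphi)$: $\mathit{sub}(p)=\{p\}$ for $p$ an atomic proposition, $\mathsf{true}$ or $\mathsf{false}$; $\mathit{sub}(\neg\varphi)=\{\neg\varphi\}\cup\mathit{sub}(\varphi)$; for $\circ\in\{\land,\lor\}$, $\mathit{sub}(\varphi\circ\psi)=\{\varphi\circ\psi\}\cup\mathit{sub}(\varphi)\cup\mathit{sub}(\psi)$; for $Q\in\{\mathsf{A},\mathsf{E}\}$, $\mathit{sub}(Q\mathsf{X}\varphi)=\{Q\mathsf{X}\varphi\}\cup\mathit{sub}(\varphi)$, and with $\rho=Q[\varphi\,\mathsf{V}\,\psi]$, $\mathit{sub}(\rho)=\{\rho,\ Q\mathsf{X}\rho,\ \varphi\lor Q\mathsf{X}\rho,\ \psi\land(\varphi\lor Q\mathsf{X}\rho)\}\cup\mathit{sub}(\varphi)\cup\mathit{sub}(\psi)$. The propositional formula $\mathit{repair}(M,\eta)$ is over propositions $E_{s,t}$ for $(s,t)\in R$; $X_{s,\psi}$ for $s\in S$, $\psi\in\mathit{sub}(\eta)$ (and $X_{s,p}$, $p\in\mathcal{AP}$); and $X^m_{s,\psi}$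 for $s\in S$, $0\le m\le n=|S|$, and $\psi\in\mathit{sub}(\eta)$ of the form $\mathsf{A}[\varphi\,\mathsf{V}\,\varphi']$ or $\mathsf{E}[\varphi\,\mathsf{V}\,\varphi']$. It is the conjunction, over all $s\in S$ where $s$ is free, of: - $X_{s_0,\eta}$; - $\bigvee_{t\mid s\to t}E_{s,t}$; - $X_{s,p}$ for all $p\in\mathcal{AP}\cap L(s)$, and $\neg X_{s,p}$ for all $p\in\mathcal{AP}-L(s)$; - $X_{s,\neg\varphi}\equiv\neg X_{s,\varphi}$, $X_{s,\varphi\lor\psi}\equiv X_{s,\varphi}\lor X_{s,\psi}$, $X_{s,\varphi\land\psi}\equiv X_{s,\varphi}\land X_{s,\psi}$ for all $\neg\varphi$, $\varphi\lor\psi$, $\varphi\land\psi\in\mathit{sub}(\eta)$ respectively; - $X_{s,\mathsf{AX}\varphi}\equiv\bigwedge_{t\mid s\to t}(E_{s,t}\Rightarrow X_{t,\varphi})$ for all $\mathsf{AX}\varphi\in\mathit{sub}(\eta)$; $X_{s,\mathsf{EX}\varphi}\equiv\bigvee_{t\mid s\to t}(E_{s,t}\land X_{t,\varphi})$ for all $\mathsf{EX}\varphi\in\mathit{sub}(\eta)$; - for all $\rho=\mathsf{A}[\varphi\,\mathsf{V}\,\psi]\in\mathit{sub}(\eta)$: $X_{s,\rho}\equiv X^n_{s,\rho}$; $X^m_{s,\rho}\equiv X_{s,\psi}\land\bigl(X_{s,\varphi}\lor\bigwedge_{t\mid s\to t}(E_{s,t}\Rightarrow X^{m-1}_{t,\rho})\bigr)$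 for $m\in\{1,\dots,n\}$; $X^0_{s,\rho}\equiv X_{s,\psi}$; - for all $\rho=\mathsf{E}[\varphi\,\mathsf{V}\,\psi]\in\mathit{sub}(\eta)$: $X_{s,\rho}\equiv X^n_{s,\rho}$; $X^m_{s,\rho}\equiv X_{s,\psi}\land\bigl(X_{s,\varphi}\lor\bigvee_{t\mid s\to t}(E_{s,t}\land X^{m-1}_{t,\rho})\bigr)$ for $m\in\{1,\dots,n\}$; $X^0_{s,\rho}\equiv X_{s,\psi}$. For a satisfying assignment $\mathcal{V}$, $\mathit{model}(M,\mathcal{V})=(s_0',S',R',L')$, where $s_0'=s_0$, $R'=\{(s,t)\mid\mathcal{V}(E_{s,t})=\mathit{tt}\}$, $S'$ is the set of all states reachable from $s_0$ via paths of transitions in $R'$ (and $R'$ is regarded as a relation on $S'$), and $L'=L\upharpoonright S'$. Algorithm $\textsc{Repair}(M,\eta)$: model check $M,s_0\models\eta$; if this holds, return $M$. Otherwise compute $\mathit{repair}(M,\eta)$ and submit it to a sound and complete SAT solver. If the solver returns "not satisfiable", return "failure"; otherwise the solver returns a (some, arbitrary) satisfying assignment $\mathcal{V}$, and the algorithm returns $\mathit{model}(M,\mathcal{V})$. -}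

module Defs where

open import Level using (0ℓ)
open import Data.Bool as Bool using (Bool; true; false; if_then_else_)
open import Data.Empty using (⊥-elim)
open import Data.Nat using (ℕ; zero; suc; _<_)
open import Data.Fin using (Fin)
open import Data.Fin.Properties using (any?)
open import Data.Fin.Subset using (Subset; _∈_; _∉_; _⊆_; _⊃_; ⁅_⁆; _∪_; ∣_∣)
open import Data.Fin.Subset.Properties
  using (_∈?_; x∈⁅x⁆; x∈⁅y⁆⇒x≡y; x∈p∪q⁻; p⊆p∪q; q⊆p∪q)
open import Data.Fin.Subset.Induction using (⊃-wellFounded)
open import Data.List using (List; []; _∷_; [_]; _++_; map; concatMap; foldr; filter; allFin; upTo)
open import Data.Maybe using (Maybe; just; nothing)
open import Data.Product using (_×_; _,_; ∃; proj₁; proj₂; ∃-syntax)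
open import Data.Sum using (_⊎_; inj₁; inj₂)
open import Function.Bundles using (_⇔_; mk⇔; Equivalence)
open import Induction.WellFounded using (Acc; acc)
open import Relation.Binary.Core using (Rel)
open import Relation.Binary.Definitions using (Decidable)
open import Relation.Binary.Construct.Closure.ReflexiveTransitive using (Star; ε; _◅_; _◅◅_)
open import Relation.Binary.PropositionalEquality using (_≡_; refl)
open import Relation.Nullary using (¬_; Dec; yes; no; ¬?; _×-dec_)

infixr 7 _∧_
infixr 6 _∨_
infix  8 ~_

private
  variable
    k N : ℕ
    Var : Set

-- AP is finite because repair(M,η) conjoins a literal for every p ∈ AP.
data AP (k : ℕ) : Set where
  trueᵃ falseᵃ : AP k
  prop         : Fin k → AP k

allAP : ∀ k → List (AP k)
allAP k = trueᵃ ∷ falseᵃ ∷ map prop (allFin k)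

-- The states form a subset S of an ambient Fin N, so that a structure and its
-- substructures share a type of states.  The values of L outside S carry no
-- information: no definition or law below constrains them.
record Kripke (k N : ℕ) : Set₁ where
  infix 4 _⟶_ _⟶?_
  field
    S       : Subset N
    s₀      : Fin N
    s₀∈S    : s₀ ∈ S
    _⟶_     : Rel (Fin N) 0ℓ
    _⟶?_    : Decidable _⟶_
    ⟶-src   : ∀ {s t} → s ⟶ t → s ∈ S
    ⟶-tgt   : ∀ {s t} → s ⟶ t → t ∈ S
    L       : Fin N → AP k → Bool
    L-true  : ∀ {s} → s ∈ S → L s trueᵃ ≡ true
    L-false : ∀ {s} → s ∈ S → L s falseᵃ ≡ false

open Kripke public using (S; s₀)

Total : Kripke k N → Set
Total M = ∀ {s} → s ∈ S M → ∃[ t ] s ⟶ t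
  where open Kripke M using (_⟶_)

infix 4 _⊑_

record _⊑_ (M′ M : Kripke k N) : Set where
  private
    module M′ = Kripke M′
    module M  = Kripke M
  field
    S⊆ : M′.S ⊆ M.S
    s₀≡ : M′.s₀ ≡ M.s₀
    ⟶⊆ : ∀ {s t} → s M′.⟶ t → s M.⟶ t
    L↾ : ∀ {s} → s ∈ M′.S → ∀ p → M′.L s p ≡ M.L s p

-- The constants true and false of CTL are the atoms trueᵃ and falseᵃ.
data CTL (k : ℕ) : Set where
  atom          : AP k → CTL k
  ~_            : CTL k → CTL k
  _∧_ _∨_       : CTL k → CTL k → CTL k
  AX EX         : CTL k → CTL k
  A[_V_] E[_V_] : CTL k → CTL k → CTL k

record Fullpath (M : Kripke k N) (s : Fin N) (π : ℕ → Fin N) : Set where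
  open Kripke M using (_⟶_)
  field
    start : π 0 ≡ s
    step  : ∀ i → π i ⟶ π (suc i)

Releases : (P Q : Fin N → Set) → (ℕ → Fin N) → Set
Releases P Q π = ∀ m → (∀ j → j < m → ¬ P (π j)) → Q (π m)

infix 4 _,_⊨_

_,_⊨_ : Kripke k N → Fin N → CTL k → Set
M , s ⊨ atom p     = Kripke.L M s p ≡ true
M , s ⊨ ~ φ        = ¬ (M , s ⊨ φ)
M , s ⊨ φ ∧ ψ      = (M , s ⊨ φ) × (M , s ⊨ ψ)
M , s ⊨ φ ∨ ψ      = (M , s ⊨ φ) ⊎ (M , s ⊨ ψ)
M , s ⊨ AX φ       = ∀ t → s ⟶ t → M , t ⊨ φ
  where open Kripke M using (_⟶_)
M , s ⊨ EX φ       = ∃[ t ] s ⟶ t × (M , t ⊨ φ)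
  where open Kripke M using (_⟶_)
M , s ⊨ A[ φ V ψ ] = ∀ π → Fullpath M s π → Releases (λ t → M , t ⊨ φ) (λ t → M , t ⊨ ψ) π
M , s ⊨ E[ φ V ψ ] = ∃[ π ] Fullpath M s π × Releases (λ t → M , t ⊨ φ) (λ t → M , t ⊨ ψ) π

Repairable : Kripke k N → CTL k → Set₁
Repairable M η = ∃[ M′ ] M′ ⊑ M × Total M′ × (M′ , s₀ M′ ⊨ η)

sub : CTL k → List (CTL k)
sub (atom p) = [ atom p ]
sub (~ φ)    = ~ φ ∷ sub φ
sub (φ ∧ ψ)  = φ ∧ ψ ∷ sub φ ++ sub ψ
sub (φ ∨ ψ)  = φ ∨ ψ ∷ sub φ ++ sub ψ
sub (AX φ)   = AX φ ∷ sub φ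
sub (EX φ)   = EX φ ∷ sub φ
sub ρ@(A[ φ V ψ ]) = ρ ∷ AX ρ ∷ φ ∨ AX ρ ∷ ψ ∧ (φ ∨ AX ρ) ∷ sub φ ++ sub ψ
sub ρ@(E[ φ V ψ ]) = ρ ∷ EX ρ ∷ φ ∨ EX ρ ∷ ψ ∧ (φ ∨ EX ρ) ∷ sub φ ++ sub ψ

data Formula (Var : Set) : Set where
  var     : Var → Formula Var
  ⊤ ⊥     : Formula Var
  ~_      : Formula Var → Formula Var
  _∧_ _∨_ : Formula Var → Formula Var → Formula Var

infixr 5 _⇒_
infix  4 _⇔ᶠ_

_⇒_ _⇔ᶠ_ : Formula Var → Formula Var → Formula Var
f ⇒ g  = ~ f ∨ g
f ⇔ᶠ g = (f ⇒ g) ∧ (g ⇒ f)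

⋀ ⋁ : List (Formula Var) → Formula Var
⋀ = foldr _∧_ ⊤
⋁ = foldr _∨_ ⊥

eval : (Var → Bool) → Formula Var → Bool
eval 𝒱 (var x) = 𝒱 x
eval 𝒱 ⊤       = true
eval 𝒱 ⊥       = false
eval 𝒱 (~ f)   = Bool.not (eval 𝒱 f)
eval 𝒱 (f ∧ g) = eval 𝒱 f Bool.∧ eval 𝒱 g
eval 𝒱 (f ∨ g) = eval 𝒱 f Bool.∨ eval 𝒱 g

Satisfiable : Formula Var → Set
Satisfiable f = ∃[ 𝒱 ] eval 𝒱 f ≡ true

-- The propositions E_{s,t}, X_{s,ψ} and X^m_{s,ψ}.  Their indices are not
-- restricted here; repair mentions E s t only for transitions of M, and the
-- X and Xᵐ only for states of M, for ψ ∈ sub η (or an atom), and for m ≤ |S|.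
data RepairVar (k N : ℕ) : Set where
  E  : Fin N → Fin N → RepairVar k N
  X  : Fin N → CTL k → RepairVar k N
  Xᵐ : ℕ → Fin N → CTL k → RepairVar k N

module _ (M : Kripke k N) where
  open Kripke M using (_⟶_; _⟶?_; L)

  private
    n : ℕ
    n = ∣ S M ∣

    succs : Fin N → List (Fin N)
    succs s = filter (s ⟶?_) (allFin N)

    e : Fin N → Fin N → Formula (RepairVar k N)
    e s t = var (E s t)

    x : Fin N → CTL k → Formula (RepairVar k N)
    x s ψ = var (X s ψ)

    xᵐ : ℕ → Fin N → CTL k → Formula (RepairVar k N)
    xᵐ m s ψ = var (Xᵐ m s ψ)

  label : Fin N → AP k → Formula (RepairVar k N)
  label s p = if L s p then x s (atom p) else ~ x s (atom p)

  clauses : Fin N → CTL k → List (Formula (RepairVar k N))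
  clauses s (atom p) = []
  clauses s (~ φ)    = [ x s (~ φ) ⇔ᶠ ~ x s φ ]
  clauses s (φ ∧ ψ)  = [ x s (φ ∧ ψ) ⇔ᶠ x s φ ∧ x s ψ ]
  clauses s (φ ∨ ψ)  = [ x s (φ ∨ ψ) ⇔ᶠ x s φ ∨ x s ψ ]
  clauses s (AX φ)   = [ x s (AX φ) ⇔ᶠ ⋀ (map (λ t → e s t ⇒ x t φ) (succs s)) ]
  clauses s (EX φ)   = [ x s (EX φ) ⇔ᶠ ⋁ (map (λ t → e s t ∧ x t φ) (succs s)) ]
  clauses s ρ@(A[ φ V ψ ]) =
    (x s ρ ⇔ᶠ xᵐ n s ρ) ∷
    (xᵐ 0 s ρ ⇔ᶠ x s ψ) ∷
    map (λ m → xᵐ (suc m) s ρ ⇔ᶠ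
           x s ψ ∧ (x s φ ∨ ⋀ (map (λ t → e s t ⇒ xᵐ m t ρ) (succs s))))
        (upTo n)
  clauses s ρ@(E[ φ V ψ ]) =
    (x s ρ ⇔ᶠ xᵐ n s ρ) ∷
    (xᵐ 0 s ρ ⇔ᶠ x s ψ) ∷
    map (λ m → xᵐ (suc m) s ρ ⇔ᶠ
           x s ψ ∧ (x s φ ∨ ⋁ (map (λ t → e s t ∧ xᵐ m t ρ) (succs s))))
        (upTo n)

  stateClauses : CTL k → Fin N → List (Formula (RepairVar k N))
  stateClauses η s =
    ⋁ (map (e s) (succs s)) ∷ map (label s) (allAP k) ++ concatMap (clauses s) (sub η)

  repair : CTL k → Formula (RepairVar k N)
  repair η = ⋀ (x (s₀ M) η ∷ concatMap (stateClauses η) (filter (_∈? S M) (allFin N)))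

module _ {_↝_ : Rel (Fin N) 0ℓ} (_↝?_ : Decidable _↝_) (s : Fin N) where

  private
    Exit : Subset N → Set
    Exit p = ∃[ u ] ∃[ v ] (u ∈ p × v ∉ p × u ↝ v)

    exit? : ∀ p → Dec (Exit p)
    exit? p = any? λ u → any? λ v → (u ∈? p) ×-dec (¬? (v ∈? p) ×-dec (u ↝? v))

    grow : ∀ p → Acc _⊃_ p → s ∈ p → (∀ t → t ∈ p → Star _↝_ s t) →
           ∃[ q ] (∀ t → t ∈ q ⇔ Star _↝_ s t)
    grow p (acc rs) s∈p sound with exit? p
    ... | yes (u , v , u∈p , v∉p , u↝v) =
      grow (p ∪ ⁅ v ⁆) (rs (p⊆p∪q ⁅ v ⁆ , v , q⊆p∪q p ⁅ v ⁆ (x∈⁅x⁆ v) , v∉p))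
           (p⊆p∪q ⁅ v ⁆ s∈p) sound′
      where
      sound′ : ∀ t → t ∈ p ∪ ⁅ v ⁆ → Star _↝_ s t
      sound′ t t∈ with x∈p∪q⁻ p ⁅ v ⁆ t∈
      ... | inj₁ t∈p = sound t t∈p
      ... | inj₂ t∈v with refl ← x∈⁅y⁆⇒x≡y v t∈v = sound u u∈p ◅◅ (u↝v ◅ ε)
    ... | no closed = p , λ t → mk⇔ (sound t) (complete s∈p)
      where
      complete : ∀ {u t} → u ∈ p → Star _↝_ u t → t ∈ p
      complete u∈p ε = u∈p
      complete {u} u∈p (_◅_ {j = v} u↝v v↝*t) with v ∈? p
      ... | yes v∈p = complete v∈p v↝*t
      ... | no  v∉p = ⊥-elim (closed (u , v , u∈p , v∉p , u↝v))

    start-sound : ∀ t → t ∈ ⁅ s ⁆ → Star _↝_ s t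
    start-sound t t∈ with refl ← x∈⁅y⁆⇒x≡y s t∈ = ε

    closure : ∃[ q ] (∀ t → t ∈ q ⇔ Star _↝_ s t)
    closure = grow ⁅ s ⁆ (⊃-wellFounded ⁅ s ⁆) (x∈⁅x⁆ s) start-sound

  reachable : Subset N
  reachable = proj₁ closure

  ∈-reachable : ∀ t → t ∈ reachable ⇔ Star _↝_ s t
  ∈-reachable = proj₂ closure

module _ (M : Kripke k N) (𝒱 : RepairVar k N → Bool) where
  open Kripke M using (_⟶_; _⟶?_; s₀∈S; ⟶-tgt; L; L-true; L-false)

  Kept : Rel (Fin N) 0ℓ
  Kept s t = s ⟶ t × 𝒱 (E s t) ≡ true

  kept? : Decidable Kept
  kept? s t = (s ⟶? t) ×-dec (𝒱 (E s t) Bool.≟ true)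

  private
    S′ : Subset N
    S′ = reachable kept? (s₀ M)

    S′⊆S : S′ ⊆ S M
    S′⊆S {t} t∈ = stays s₀∈S (Equivalence.to (∈-reachable kept? (s₀ M) t) t∈)
      where
      stays : ∀ {u v} → u ∈ S M → Star Kept u v → v ∈ S M
      stays u∈ ε                   = u∈
      stays u∈ ((u⟶v , _) ◅ v↝*w) = stays (⟶-tgt u⟶v) v↝*w

  model : Kripke k N
  model = record
    { S       = S′
    ; s₀      = s₀ M
    ; s₀∈S    = Equivalence.from (∈-reachable kept? (s₀ M) (s₀ M)) ε
    ; _⟶_     = λ s t → s ∈ S′ × t ∈ S′ × Kept s t
    ; _⟶?_    = λ s t → (s ∈? S′) ×-dec ((t ∈? S′) ×-dec kept? s t)
    ; ⟶-src   = λ st → proj₁ st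
    ; ⟶-tgt   = λ st → proj₁ (proj₂ st)
    ; L       = L
    ; L-true  = λ s∈ → L-true (S′⊆S s∈)
    ; L-false = λ s∈ → L-false (S′⊆S s∈)
    }

ModelChecker : (k N : ℕ) → Set₁
ModelChecker k N = (M : Kripke k N) → Total M → (η : CTL k) → Dec (M , s₀ M ⊨ η)

-- Soundness and completeness are carried by Dec.  A theorem about an arbitrary
-- solver covers every choice of satisfying assignment.
SATSolver : Set → Set
SATSolver Var = (f : Formula Var) → Dec (Satisfiable f)

-- The result nothing is the answer "failure".
Repair : ModelChecker k N → SATSolver (RepairVar k N) →
         (M : Kripke k N) → Total M → CTL k → Maybe (Kripke k N)
Repair check solve M total η with check M total η
... | yes _ = just M
... | no  _ with solve (repair M η)
...   | no  _        = nothing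
...   | yes (𝒱 , _) = just (model M 𝒱)

{-# OPTIONS --safe #-}
module Submission where

-- If an assignment satisfies the clauses of repair(M,η), then X_{s,ψ} agrees with
-- K,s ⊨ ψ in every total K ⊑ M whose transitions are the kept ones at each of its
-- states.  For the release operators, the sets {s | X^m_{s,ρ}} decrease with m, so
-- they are constant from m = |S| on and the limit is the greatest fixed point.
-- Applied to K = model(M,𝒱) this is soundness.  Applied to the given repair K, with
-- the assignment that evaluates every subformula on M with the transitions of K, it
-- shows that repair(M,η) is satisfiable.

open import Defs
open import Data.Bool as Bool using (Bool; true; false; T; not)
open import Data.Bool.ListAction using (all; any)
open import Data.Bool.Properties using (T-≡; T-∧; T-∨; T?)
open import Data.Fin using (Fin)
open import Data.Fin.Properties using (any?; all?)
open import Data.Fin.Subset using (_∈_; _-_; ∣_∣)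
open import Data.Fin.Subset.Properties
  using (_∈?_; x∈p∧x≢y⇒x∈p-y; x∈p⇒∣p-x∣<∣p∣; p⊆q⇒∣p∣≤∣q∣)
open import Data.List as List using (List; []; _∷_; map; filter; allFin; upTo)
open import Data.List.Membership.Propositional using () renaming (_∈_ to _∈ˡ_)
open import Data.List.Membership.Propositional.Properties
  using (∈-filter⁺; ∈-filter⁻; ∈-allFin; ∈-upTo⁺; ∈-map⁺; ∈-++⁺ˡ; ∈-++⁺ʳ)
open import Data.List.Relation.Unary.All as All using (All; []; _∷_)
import Data.List.Relation.Unary.All.Properties as All
open import Data.List.Relation.Unary.Any using (here; there)
open import Data.Maybe using (just)
open import Data.Nat using (ℕ; zero; suc; _+_; _≤_; _<_; s≤s)
open import Data.Nat.Properties using (≤-trans; ≤-refl; <⇒≤; m<n⇒m<1+n; +-suc; +-identityʳ)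
open import Data.Product using (_×_; _,_; proj₁; proj₂; ∃-syntax)
open import Data.Product.Function.NonDependent.Propositional using (_×-⇔_)
open import Data.Sum using (_⊎_; inj₁; inj₂)
open import Data.Sum.Function.Propositional using (_⊎-⇔_)
open import Function using (_∘_; id; _$_)
open import Function.Bundles using (_⇔_; mk⇔; Equivalence)
open import Function.Construct.Composition using (_⇔-∘_)
open import Function.Related.TypeIsomorphisms using (¬-cong-⇔)
open import Level using (0ℓ)
open import Relation.Binary.Construct.Closure.ReflexiveTransitive using (Star; ε; _◅_; _◅◅_)
open import Relation.Binary.PropositionalEquality using (_≡_; refl; sym; trans; cong; subst)
open import Relation.Nullary using (¬_; Dec; yes; no; does; ¬?; contradiction; _×-dec_; _⊎-dec_)
open import Relation.Nullary.Decidable as Dec using (map′; decidable-stable)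
open import Relation.Unary using (Pred)

open Equivalence using (to; from)

private
  variable
    k N : ℕ
    A Var : Set

-- Satisfaction of propositional formulas

T-not : ∀ {b} → T (not b) ⇔ (¬ T b)
T-not {false} = mk⇔ (λ _ ()) _
T-not {true}  = mk⇔ (λ ()) (λ ¬t → ¬t _)

module Satisfaction (𝒱 : Var → Bool) where

  infix 4 ⊩_

  ⊩_ : Formula Var → Set
  ⊩ f = T (eval 𝒱 f)

  ⊩-⇒ : ∀ f g → ⊩ (f ⇒ g) ⇔ (⊩ f → ⊩ g)
  ⊩-⇒ f g with eval 𝒱 f
  ... | true  = mk⇔ (λ g _ → g) (λ h → h _)
  ... | false = mk⇔ (λ _ ()) _

  ⊩-⇔ : ∀ f g → ⊩ (f ⇔ᶠ g) → (⊩ f) ⇔ (⊩ g)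
  ⊩-⇔ f g h with fg , gf ← T-∧ {eval 𝒱 (f ⇒ g)} .to h = mk⇔ (⊩-⇒ f g .to fg) (⊩-⇒ g f .to gf)

  ≡⇒⊩-⇔ : ∀ f g → eval 𝒱 f ≡ eval 𝒱 g → ⊩ (f ⇔ᶠ g)
  ≡⇒⊩-⇔ f g eq = T-∧ .from
    (⊩-⇒ f g .from (subst T eq) , ⊩-⇒ g f .from (subst T (sym eq)))

  ⊩-⋀ : ∀ fs → ⊩ ⋀ fs ⇔ All ⊩_ fs
  ⊩-⋀ []       = mk⇔ (λ _ → []) _
  ⊩-⋀ (f ∷ fs) = mk⇔
    (λ h → let hf , hfs = T-∧ {eval 𝒱 f} .to h in hf ∷ ⊩-⋀ fs .to hfs)
    (λ where (hf ∷ hfs) → T-∧ .from (hf , ⊩-⋀ fs .from hfs))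

  ⊩-⋁ : ∀ (f : A → Formula Var) xs → ⊩ ⋁ (map f xs) ⇔ (∃[ x ] x ∈ˡ xs × (⊩ f x))
  ⊩-⋁ f []       = mk⇔ (λ ()) (λ ())
  ⊩-⋁ f (x ∷ xs) = mk⇔ find build
    where
    find : ⊩ ⋁ (map f (x ∷ xs)) → ∃[ y ] y ∈ˡ x ∷ xs × (⊩ f y)
    find h with T-∨ {eval 𝒱 (f x)} .to h
    ... | inj₁ hx  = x , here refl , hx
    ... | inj₂ hxs with y , y∈ , hy ← ⊩-⋁ f xs .to hxs = y , there y∈ , hy
    build : ∃[ y ] y ∈ˡ x ∷ xs × (⊩ f y) → ⊩ ⋁ (map f (x ∷ xs))
    build (y , here refl , hy) = T-∨ .from (inj₁ hy)
    build (y , there y∈ , hy)  = T-∨ {eval 𝒱 (f x)} .from (inj₂ (⊩-⋁ f xs .from (y , y∈ , hy)))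

  -- As an equality of Booleans, this (like `eval-⋁`) lets an assignment defined with `all` or `any`
  -- meet an equivalence clause through `≡⇒⊩-⇔`.
  eval-⋀ : ∀ (f : A → Formula Var) xs → eval 𝒱 (⋀ (map f xs)) ≡ all (eval 𝒱 ∘ f) xs
  eval-⋀ f []       = refl
  eval-⋀ f (x ∷ xs) = cong (eval 𝒱 (f x) Bool.∧_) (eval-⋀ f xs)

  eval-⋁ : ∀ (f : A → Formula Var) xs → eval 𝒱 (⋁ (map f xs)) ≡ any (eval 𝒱 ∘ f) xs
  eval-⋁ f []       = refl
  eval-⋁ f (x ∷ xs) = cong (eval 𝒱 (f x) Bool.∨_) (eval-⋁ f xs)

-- Release operators as greatest fixed points in a total structure

module Release (K : Kripke k N) (total : Total K) where
  open Kripke K using (_⟶_; _⟶?_; ⟶-tgt)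

  □ ◇ : Pred (Fin N) 0ℓ → Pred (Fin N) 0ℓ
  □ U s = ∀ t → s ⟶ t → U t
  ◇ U s = ∃[ t ] s ⟶ t × U t

  -- What the fixed point argument needs of `□` and `◇`, so that A and E share it. U and V matter
  -- only on `S K`, because transitions of K end there.
  record Modality (◯ : Pred (Fin N) 0ℓ → Pred (Fin N) 0ℓ) : Set₁ where
    field
      monotone : ∀ {U V s} → (∀ {t} → t ∈ S K → U t → V t) → ◯ U s → ◯ V s
      decide   : ∀ {U s} → (∀ {t} → t ∈ S K → Dec (U t)) → Dec (◯ U s)

    cong-⇔ : ∀ {U V s} → (∀ {t} → t ∈ S K → U t ⇔ V t) → ◯ U s ⇔ ◯ V s
    cong-⇔ U⇔V = mk⇔ (monotone (λ t∈ → U⇔V t∈ .to)) (monotone (λ t∈ → U⇔V t∈ .from))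

  □-modality : Modality □
  □-modality = record
    { monotone = λ U⇒V h t s⟶t → U⇒V (⟶-tgt s⟶t) (h t s⟶t)
    ; decide   = λ {U} {s} U? → all? λ t → decide U? s t
    }
    where
    decide : ∀ {U : Pred (Fin N) 0ℓ} → (∀ {t} → t ∈ S K → Dec (U t)) → ∀ s t → Dec (s ⟶ t → U t)
    decide U? s t with s ⟶? t
    ... | yes s⟶t = map′ (λ u _ → u) (_$ s⟶t) (U? (⟶-tgt s⟶t))
    ... | no  s↛t = yes λ s⟶t → contradiction s⟶t s↛t

  ◇-modality : Modality ◇
  ◇-modality = record
    { monotone = λ where U⇒V (t , s⟶t , u) → t , s⟶t , U⇒V (⟶-tgt s⟶t) u
    ; decide   = λ {U} {s} U? → any? λ t → decide U? s t
    }
    where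
    decide : ∀ {U : Pred (Fin N) 0ℓ} → (∀ {t} → t ∈ S K → Dec (U t)) → ∀ s t → Dec (s ⟶ t × U t)
    decide U? s t with s ⟶? t
    ... | yes s⟶t = map′ (s⟶t ,_) proj₂ (U? (⟶-tgt s⟶t))
    ... | no  s↛t = no λ (s⟶t , _) → s↛t s⟶t

  trace : (∀ {s} → s ∈ S K → ∃[ t ] s ⟶ t) → ∀ {s} → s ∈ S K → ℕ → ∃[ t ] t ∈ S K
  trace next s∈ zero    = _ , s∈
  trace next s∈ (suc i) =
    let t , t∈ = trace next s∈ i ; u , t⟶u = next t∈ in u , ⟶-tgt t⟶u

  trace-fullpath : ∀ (next : ∀ {s} → s ∈ S K → ∃[ t ] s ⟶ t) {s} (s∈ : s ∈ S K) →
                   Fullpath K s (proj₁ ∘ trace next s∈)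
  trace-fullpath next s∈ = record
    { start = refl
    ; step  = λ i → proj₂ (next (proj₂ (trace next s∈ i)))
    }

  module _ {P Q : Pred (Fin N) 0ℓ}
           (P? : ∀ {s} → s ∈ S K → Dec (P s)) (Q? : ∀ {s} → s ∈ S K → Dec (Q s)) where

    module Iterates {◯} (modality : Modality ◯) where
      open Modality modality

      -- The approximants of the greatest fixed point νZ. Q ∧ (P ∨ ◯Z), in the recursion of the
      -- propositions X^m.
      Bounded : ℕ → Pred (Fin N) 0ℓ
      Bounded zero    s = Q s
      Bounded (suc m) s = Q s × (P s ⊎ ◯ (Bounded m) s)

      Bounded-Q : ∀ m {s} → Bounded m s → Q s
      Bounded-Q zero    q       = q
      Bounded-Q (suc m) (q , _) = q

      Bounded? : ∀ m {s} → s ∈ S K → Dec (Bounded m s)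
      Bounded? zero    s∈ = Q? s∈
      Bounded? (suc m) s∈ = Q? s∈ ×-dec (P? s∈ ⊎-dec decide (Bounded? m))

      -- Induction on m, replacing `r m` under ◯ by congruence. The recurrence is assumed only for m
      -- < n since the clauses stop at X^n.
      Bounded-characterisation :
        ∀ {n} (r : ℕ → Pred (Fin N) 0ℓ) →
        (∀ {s} → s ∈ S K → r 0 s ⇔ Q s) →
        (∀ {m s} → m < n → s ∈ S K → r (suc m) s ⇔ (Q s × (P s ⊎ ◯ (r m) s))) →
        ∀ m → m ≤ n → ∀ {s} → s ∈ S K → r m s ⇔ Bounded m s
      Bounded-characterisation r r₀ r₊ zero    _   s∈ = r₀ s∈
      Bounded-characterisation r r₀ r₊ (suc m) m<n s∈ =
        (mk⇔ id id ×-⇔ (mk⇔ id id ⊎-⇔ cong-⇔ (Bounded-characterisation r r₀ r₊ m (<⇒≤ m<n))))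
          ⇔-∘ r₊ m<n s∈

      -- As the approximants decrease, this inclusion makes the m-th one a fixed point on `S K`.
      Stable : ℕ → Set
      Stable m = ∀ {s} → s ∈ S K → Bounded m s → Bounded (suc m) s

      Stable-suc : ∀ m → Stable m → Stable (suc m)
      Stable-suc m stable s∈ (q , inj₁ p) = q , inj₁ p
      Stable-suc m stable s∈ (q , inj₂ h) = q , inj₂ (monotone stable h)

      Stable-+ : ∀ d m → Stable m → Stable (d + m)
      Stable-+ zero    m stable = stable
      Stable-+ (suc d) m stable = Stable-suc (d + m) (Stable-+ d m stable)

      -- Every level implies Q, which is level 0; monotonicity of ◯ lifts the inclusion to the
      -- higher levels.
      Bounded-antitone : ∀ m {s} → s ∈ S K → Bounded (suc m) s → Bounded m s
      Bounded-antitone zero    s∈ (q , _)      = q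
      Bounded-antitone (suc m) s∈ (q , inj₁ p) = q , inj₁ p
      Bounded-antitone (suc m) s∈ (q , inj₂ h) = q , inj₂ (monotone (Bounded-antitone m) h)

      Drops : ℕ → Pred (Fin N) 0ℓ
      Drops m s = s ∈ S K × Bounded m s × ¬ Bounded (suc m) s

      drops? : ∀ m s → Dec (Drops m s)
      drops? m s with s ∈? S K
      ... | no  s∉ = no (s∉ ∘ proj₁)
      ... | yes s∈ = map′ (s∈ ,_) proj₂ (Bounded? m s∈ ×-dec ¬? (Bounded? (suc m) s∈))

      -- Each unstable step removes a state, and p bounds the states that remain.
      stabilises : ∀ d m p → ∣ p ∣ ≤ d → (∀ {s} → s ∈ S K → Bounded m s → s ∈ p) → Stable (d + m)
      stabilises d m p ∣p∣≤d m⊆p with any? (drops? m)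
      ... | no none = Stable-+ d m λ {s} s∈ b →
        decidable-stable (Bounded? (suc m) s∈) λ ¬b → none (s , s∈ , b , ¬b)
      ... | yes (s , s∈ , b , ¬b) with d | ≤-trans (x∈p⇒∣p-x∣<∣p∣ (m⊆p s∈ b)) ∣p∣≤d
      ...   | suc d | s≤s ∣p-s∣≤d =
        subst Stable (+-suc d m) (stabilises d (suc m) (p - s) ∣p-s∣≤d λ {t} t∈ bt →
          x∈p∧x≢y⇒x∈p-y (m⊆p t∈ (Bounded-antitone m t∈ bt)) λ where refl → ¬b bt)

      -- `S K` bounds level 0, so at most |S K| levels can lose a state.
      stable : ∀ {n} → ∣ S K ∣ ≤ n → Stable n
      stable {n} ∣S∣≤n =
        subst Stable (+-identityʳ n) (stabilises n 0 (S K) ∣S∣≤n (λ s∈ _ → s∈))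

    module _ where
      open Iterates □-modality

      -- As long as P has not held, the path stays in level n: stability unfolds level n at the
      -- current state, the disjunct P is excluded, and so the next state is in level n.
      Bounded⇒AV : ∀ {n} → ∣ S K ∣ ≤ n → ∀ {s} → s ∈ S K → Bounded n s →
                   ∀ π → Fullpath K s π → Releases P Q π
      Bounded⇒AV {n} ∣S∣≤n s∈ b π path m ¬P = Bounded-Q n (proj₂ (reach m ¬P))
        where
        open Fullpath path
        reach : ∀ m → (∀ j → j < m → ¬ P (π j)) → π m ∈ S K × Bounded n (π m)
        reach zero    ¬P rewrite start = s∈ , b
        reach (suc m) ¬P with πm∈ , bm ← reach m (λ j j<m → ¬P j (m<n⇒m<1+n j<m))
                         with stable ∣S∣≤n πm∈ bm
        ... | _ , inj₁ p = contradiction p (¬P m ≤-refl)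
        ... | _ , inj₂ h = ⟶-tgt (step m) , h _ (step m)

      -- Induction on m. If P fails at s, prefixing s to a fullpath from a successor gives a
      -- fullpath from s, and its release condition at i + 1 is that of the tail at i.
      AV⇒Bounded : ∀ m {s} → s ∈ S K →
                   (∀ π → Fullpath K s π → Releases P Q π) → Bounded m s
      AV⇒Bounded m {s} s∈ h = go m
        where
        q : Q s
        -- Totality supplies a fullpath from s, without which the universal hypothesis would say
        -- nothing about s.
        q = h _ (trace-fullpath total s∈) 0 (λ _ ())
        go : ∀ m → Bounded m s
        go zero = q
        go (suc m) with P? s∈
        ... | yes p = q , inj₁ p
        ... | no ¬p = q , inj₂ λ t s⟶t → AV⇒Bounded m (⟶-tgt s⟶t) λ π path i ¬P →
          h (λ where zero → s
                     (suc j) → π j)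
            (record { start = refl
                    ; step  = λ where zero → subst (s ⟶_) (sym (Fullpath.start path)) s⟶t
                                      (suc j) → Fullpath.step path j })
            (suc i)
            λ where zero _ → ¬p
                    (suc j) (s≤s j<i) → ¬P j j<i

    module _ where
      open Iterates ◇-modality

      Bounded⇒EV : ∀ {n} → ∣ S K ∣ ≤ n → ∀ {s} → s ∈ S K → Bounded n s →
                   ∃[ π ] Fullpath K s π × Releases P Q π
      Bounded⇒EV {n} ∣S∣≤n s∈ b =
        _ , trace-fullpath next s∈ , λ m ¬P → Bounded-Q n (reach m ¬P)
        where
        -- A choice on all of `S K`, so that it can be iterated. Outside level n, or where the
        -- unfolding yields P, any successor will do because the last component is conditional.
        guided : ∀ {s} → s ∈ S K → ∃[ t ] s ⟶ t × (Bounded n s → ¬ P s → Bounded n t)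
        guided s∈ with Bounded? n s∈
        ... | no ¬b with t , s⟶t ← total s∈ = t , s⟶t , λ b → contradiction b ¬b
        ... | yes b with stable ∣S∣≤n s∈ b
        ...   | _ , inj₂ (t , s⟶t , bt) = t , s⟶t , λ _ _ → bt
        ...   | _ , inj₁ p with t , s⟶t ← total s∈ = t , s⟶t , λ _ ¬p → contradiction p ¬p

        next : ∀ {s} → s ∈ S K → ∃[ t ] s ⟶ t
        next s∈ = let t , s⟶t , _ = guided s∈ in t , s⟶t

        π : ℕ → Fin N
        π = proj₁ ∘ trace next s∈

        reach : ∀ m → (∀ j → j < m → ¬ P (π j)) → Bounded n (π m)
        reach zero    ¬P = b
        reach (suc m) ¬P = proj₂ (proj₂ (guided (proj₂ (trace next s∈ m))))
          (reach m (λ j j<m → ¬P j (m<n⇒m<1+n j<m))) (¬P m ≤-refl)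

      -- Position 0 of the path gives Q at s; if P fails there, the tail from `π 1` is a witness one
      -- level down.
      EV⇒Bounded : ∀ m {s} → s ∈ S K →
                   (∃[ π ] Fullpath K s π × Releases P Q π) → Bounded m s
      EV⇒Bounded zero s∈ (π , record { start = refl } , rel) = rel 0 (λ _ ())
      EV⇒Bounded (suc m) s∈ (π , path@record { start = refl ; step = step } , rel) with P? s∈
      ... | yes p = rel 0 (λ _ ()) , inj₁ p
      ... | no ¬p = rel 0 (λ _ ()) , inj₂
        (π 1 , step 0 , EV⇒Bounded m (⟶-tgt (step 0))
          (π ∘ suc , record { start = refl ; step = step ∘ suc } , λ i ¬P → rel (suc i) λ where
            zero _ → ¬p
            (suc j) (s≤s j<i) → ¬P j j<i))

-- Agreement of the propositions X with the semantics

module Correctness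
  (M K : Kripke k N) (K⊑M : K ⊑ M) (total : Total K) (𝒱 : RepairVar k N → Bool)
  (kept : ∀ {s t} → s ∈ S K → Kripke._⟶_ K s t ⇔ (Kripke._⟶_ M s t × T (𝒱 (E s t))))
  (labels : ∀ {s} → s ∈ S M → ∀ p → T (𝒱 (X s (atom p))) ⇔ (Kripke.L M s p ≡ true))
  where
  private
    module M = Kripke M
    module K = Kripke K
  open _⊑_ K⊑M
  open Satisfaction 𝒱
  open Release K total

  succs : Fin N → List (Fin N)
  succs s = filter (s M.⟶?_) (allFin N)

  □ᶠ ◇ᶠ : Fin N → (Fin N → Formula (RepairVar k N)) → Formula (RepairVar k N)
  □ᶠ s f = ⋀ (map (λ t → var (E s t) ⇒ f t) (succs s))
  ◇ᶠ s f = ⋁ (map (λ t → var (E s t) ∧ f t) (succs s))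

  -- `succs` runs over the transitions of M; by `kept`, the guard E_{s,t} leaves exactly those of K.
  ⊩-□ᶠ : ∀ f {s} → s ∈ S K → ⊩ □ᶠ s f ⇔ □ (λ t → ⊩ f t) s
  ⊩-□ᶠ f {s} s∈ = mk⇔
    (λ h t s⟶t → let s⟶t , e = kept s∈ .to s⟶t in
      ⊩-⇒ (var (E s t)) (f t) .to
        (All.lookup (All.map⁻ (⊩-⋀ _ .to h)) (∈-filter⁺ (s M.⟶?_) (∈-allFin t) s⟶t)) e)
    (λ h → ⊩-⋀ _ .from (All.map⁺ (All.tabulate λ {t} t∈ →
      ⊩-⇒ (var (E s t)) (f t) .from λ e →
        h t (kept s∈ .from (proj₂ (∈-filter⁻ (s M.⟶?_) {xs = allFin N} t∈) , e)))))

  ⊩-◇ᶠ : ∀ f {s} → s ∈ S K → ⊩ ◇ᶠ s f ⇔ ◇ (λ t → ⊩ f t) s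
  ⊩-◇ᶠ f {s} s∈ = mk⇔
    (λ h → let t , t∈ , et∧ft = ⊩-⋁ _ (succs s) .to h ; e , ft = T-∧ .to et∧ft in
      t , kept s∈ .from (proj₂ (∈-filter⁻ (s M.⟶?_) {xs = allFin N} t∈) , e) , ft)
    (λ (t , s⟶t , ft) → let s⟶t , e = kept s∈ .to s⟶t in
      ⊩-⋁ _ (succs s) .from
        (t , ∈-filter⁺ (s M.⟶?_) (∈-allFin t) s⟶t , T-∧ .from (e , ft)))

  module ReleaseClauses
    {◯} (modality : Modality ◯)
    (◯ᶠ : Fin N → (Fin N → Formula (RepairVar k N)) → Formula (RepairVar k N))
    (⊩-◯ᶠ : ∀ f {s} → s ∈ S K → ⊩ ◯ᶠ s f ⇔ ◯ (λ t → ⊩ f t) s)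
    {ρ φ ψ : CTL k} {P Q : Pred (Fin N) 0ℓ}
    (φ⇔P : ∀ {s} → s ∈ S K → T (𝒱 (X s φ)) ⇔ P s)
    (ψ⇔Q : ∀ {s} → s ∈ S K → T (𝒱 (X s ψ)) ⇔ Q s)
    (clauses : ∀ {s} → s ∈ S M → All ⊩_
      ( (var (X s ρ) ⇔ᶠ var (Xᵐ ∣ S M ∣ s ρ))
      ∷ (var (Xᵐ 0 s ρ) ⇔ᶠ var (X s ψ))
      ∷ map (λ m → var (Xᵐ (suc m) s ρ) ⇔ᶠ
               var (X s ψ) ∧ (var (X s φ) ∨ ◯ᶠ s (λ t → var (Xᵐ m t ρ))))
            (upTo ∣ S M ∣)))
    where

    -- Truth of a CTL formula quantifies over infinite paths; it is decided here by the value of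
    -- X_{s,φ}.
    P? : ∀ {s} → s ∈ S K → Dec (P s)
    P? s∈ = Dec.map (φ⇔P s∈) (T? _)

    Q? : ∀ {s} → s ∈ S K → Dec (Q s)
    Q? s∈ = Dec.map (ψ⇔Q s∈) (T? _)

    open Iterates P? Q? modality

    Xᵐ-zero : ∀ {s} → s ∈ S K → T (𝒱 (Xᵐ 0 s ρ)) ⇔ Q s
    Xᵐ-zero {s} s∈ with _ ∷ c ∷ _ ← clauses (S⊆ s∈) =
      ψ⇔Q s∈ ⇔-∘ ⊩-⇔ (var (Xᵐ 0 s ρ)) (var (X s ψ)) c

    Xᵐ-suc : ∀ {m s} → m < ∣ S M ∣ → s ∈ S K →
             T (𝒱 (Xᵐ (suc m) s ρ)) ⇔ (Q s × (P s ⊎ ◯ (λ t → T (𝒱 (Xᵐ m t ρ))) s))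
    Xᵐ-suc {m} {s} m<n s∈ with _ ∷ _ ∷ cs ← clauses (S⊆ s∈) =
      (ψ⇔Q s∈ ×-⇔ ((φ⇔P s∈ ⊎-⇔ ⊩-◯ᶠ _ s∈) ⇔-∘ T-∨))
        ⇔-∘ (T-∧ ⇔-∘ ⊩-⇔ (var (Xᵐ (suc m) s ρ))
                        (var (X s ψ) ∧ (var (X s φ) ∨ ◯ᶠ s (λ t → var (Xᵐ m t ρ))))
                        (All.lookup (All.map⁻ cs) (∈-upTo⁺ m<n)))

    X⇔Bounded : ∀ {s} → s ∈ S K → T (𝒱 (X s ρ)) ⇔ Bounded ∣ S M ∣ s
    X⇔Bounded {s} s∈ with c ∷ _ ← clauses (S⊆ s∈) =
      Bounded-characterisation (λ m t → T (𝒱 (Xᵐ m t ρ))) Xᵐ-zero Xᵐ-suc ∣ S M ∣ ≤-refl s∈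
        ⇔-∘ ⊩-⇔ (var (X s ρ)) (var (Xᵐ ∣ S M ∣ s ρ)) c

  Clauses : CTL k → Set
  Clauses ψ = ∀ {s} → s ∈ S M → All ⊩_ (clauses M s ψ)

  -- Induction on ψ, with the assumed clauses restricted to `sub ψ` so that subformulas inherit
  -- them. Soundness of `model` uses the forward direction, satisfiability of `repair` the backward
  -- one.
  correct : ∀ ψ → (∀ {χ} → χ ∈ˡ sub ψ → Clauses χ) →
            ∀ {s} → s ∈ S K → T (𝒱 (X s ψ)) ⇔ (K , s ⊨ ψ)
  correct (atom p) cl s∈ =
    mk⇔ (trans (L↾ s∈ p)) (trans (sym (L↾ s∈ p))) ⇔-∘ labels (S⊆ s∈) p
  correct (~ φ) cl {s} s∈ with c ∷ [] ← cl (here refl) (S⊆ s∈) =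
    ¬-cong-⇔ (correct φ (cl ∘ there) s∈) ⇔-∘ (T-not ⇔-∘ ⊩-⇔ (var (X s (~ φ))) (~ var (X s φ)) c)
  correct (φ ∧ ψ) cl {s} s∈ with c ∷ [] ← cl (here refl) (S⊆ s∈) =
    (correct φ (cl ∘ there ∘ ∈-++⁺ˡ) s∈ ×-⇔ correct ψ (cl ∘ there ∘ ∈-++⁺ʳ (sub φ)) s∈)
      ⇔-∘ (T-∧ ⇔-∘ ⊩-⇔ (var (X s (φ ∧ ψ))) (var (X s φ) ∧ var (X s ψ)) c)
  correct (φ ∨ ψ) cl {s} s∈ with c ∷ [] ← cl (here refl) (S⊆ s∈) =
    (correct φ (cl ∘ there ∘ ∈-++⁺ˡ) s∈ ⊎-⇔ correct ψ (cl ∘ there ∘ ∈-++⁺ʳ (sub φ)) s∈)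
      ⇔-∘ (T-∨ ⇔-∘ ⊩-⇔ (var (X s (φ ∨ ψ))) (var (X s φ) ∨ var (X s ψ)) c)
  correct (AX φ) cl {s} s∈ with c ∷ [] ← cl (here refl) (S⊆ s∈) =
    Modality.cong-⇔ □-modality (correct φ (cl ∘ there))
      ⇔-∘ (⊩-□ᶠ f s∈ ⇔-∘ ⊩-⇔ (var (X s (AX φ))) (□ᶠ s f) c)
    where f = λ t → var (X t φ)
  correct (EX φ) cl {s} s∈ with c ∷ [] ← cl (here refl) (S⊆ s∈) =
    Modality.cong-⇔ ◇-modality (correct φ (cl ∘ there))
      ⇔-∘ (⊩-◇ᶠ f s∈ ⇔-∘ ⊩-⇔ (var (X s (EX φ))) (◇ᶠ s f) c)
    where f = λ t → var (X t φ)
  correct ρ@(A[ φ V ψ ]) cl s∈ =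
    -- The level |S M| of the clauses is high enough for K because `S K` is contained in `S M`.
    mk⇔ (Bounded⇒AV P? Q? (p⊆q⇒∣p∣≤∣q∣ S⊆) s∈) (AV⇒Bounded P? Q? ∣ S M ∣ s∈) ⇔-∘ X⇔Bounded s∈
    where
    cl′ : ∀ {χ} → χ ∈ˡ sub φ List.++ sub ψ → Clauses χ
    -- `sub` lists ρ and its three unfolding formulas before those of φ and ψ.
    cl′ = cl ∘ there ∘ there ∘ there ∘ there
    open ReleaseClauses □-modality □ᶠ ⊩-□ᶠ {ρ}
      (correct φ (cl′ ∘ ∈-++⁺ˡ)) (correct ψ (cl′ ∘ ∈-++⁺ʳ (sub φ))) (cl (here refl))
  correct ρ@(E[ φ V ψ ]) cl s∈ =
    mk⇔ (Bounded⇒EV P? Q? (p⊆q⇒∣p∣≤∣q∣ S⊆) s∈) (EV⇒Bounded P? Q? ∣ S M ∣ s∈) ⇔-∘ X⇔Bounded s∈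
    where
    cl′ : ∀ {χ} → χ ∈ˡ sub φ List.++ sub ψ → Clauses χ
    cl′ = cl ∘ there ∘ there ∘ there ∘ there
    open ReleaseClauses ◇-modality ◇ᶠ ⊩-◇ᶠ {ρ}
      (correct φ (cl′ ∘ ∈-++⁺ˡ)) (correct ψ (cl′ ∘ ∈-++⁺ʳ (sub φ))) (cl (here refl))

-- Satisfying assignments of `repair` and the structure `model`

module _ (M : Kripke k N) (η : CTL k) (𝒱 : RepairVar k N → Bool) where
  open Kripke M using (_⟶_; _⟶?_; L; ⟶-tgt; s₀∈S)
  open Satisfaction 𝒱

  record SatisfiesRepair : Set where
    field
      initial : T (𝒱 (X (s₀ M) η))
      serial  : ∀ {s} → s ∈ S M → ∃[ t ] s ⟶ t × T (𝒱 (E s t))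
      labels  : ∀ {s} → s ∈ S M → ∀ p → T (𝒱 (X s (atom p))) ⇔ (L s p ≡ true)
      local   : ∀ {s} → s ∈ S M → ∀ {χ} → χ ∈ˡ sub η → All ⊩_ (clauses M s χ)

  open SatisfiesRepair

  ⊩-label : ∀ s p → ⊩ label M s p ⇔ (T (𝒱 (X s (atom p))) ⇔ (L s p ≡ true))
  ⊩-label s p with L s p
  ... | true  = mk⇔ (λ h → mk⇔ (λ _ → refl) (λ _ → h)) (λ h → h .from refl)
  ... | false = mk⇔ (λ h → mk⇔ (λ x → contradiction x (T-not .to h)) λ ())
                    (λ h → T-not .from λ x → contradiction (h .to x) λ ())

  ∈-allAP : ∀ p → p ∈ˡ allAP k
  ∈-allAP trueᵃ    = here refl
  ∈-allAP falseᵃ   = there (here refl)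
  ∈-allAP (prop i) = there (there (∈-map⁺ prop (∈-allFin i)))

  -- One direction opens up the solver's assignment, the other assembles satisfiability from a given
  -- repair.
  ⊩-repair : ⊩ repair M η ⇔ SatisfiesRepair
  ⊩-repair = mk⇔ unpack pack
    where
    states : List (Fin N)
    states = filter (_∈? S M) (allFin N)

    conjuncts : List (Formula (RepairVar k N))
    conjuncts = var (X (s₀ M) η) ∷ List.concatMap (stateClauses M η) states

    unpack : ⊩ repair M η → SatisfiesRepair
    unpack h with hη ∷ hs ← ⊩-⋀ conjuncts .to h = record
      { initial = hη
      ; serial  = λ {s} s∈ →
          let t , t∈ , e = ⊩-⋁ _ (filter (s ⟶?_) (allFin N)) .to (All.head (at s∈)) in
          t , proj₂ (∈-filter⁻ (s ⟶?_) {xs = allFin N} t∈) , e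
      ; labels  = λ {s} s∈ p → ⊩-label s p .to
          (All.lookup (All.map⁻ (All.++⁻ˡ (map (label M s) (allAP k)) (All.tail (at s∈))))
                      (∈-allAP p))
      ; local   = λ {s} s∈ χ∈ → All.lookup
                  (All.map⁻ (All.concat⁻ {xss = map (clauses M s) (sub η)}
                    (All.++⁻ʳ (map (label M s) (allAP k)) (All.tail (at s∈))))) χ∈
      }
      where
      at : ∀ {s} → s ∈ S M → All ⊩_ (stateClauses M η s)
      at {s} s∈ = All.lookup (All.map⁻ (All.concat⁻ {xss = map (stateClauses M η) states} hs))
                         (∈-filter⁺ (_∈? S M) (∈-allFin s) s∈)

    pack : SatisfiesRepair → ⊩ repair M η
    pack sat = ⊩-⋀ conjuncts .from (sat .initial ∷ All.concat⁺ (All.map⁺ (All.tabulate λ s∈states →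
        let s∈ = proj₂ (∈-filter⁻ (_∈? S M) {xs = allFin N} s∈states) in
        somewhere s∈ ∷ All.++⁺ (All.map⁺ (All.tabulate λ _ → ⊩-label _ _ .from (sat .labels s∈ _)))
                               (All.concat⁺ (All.map⁺ (All.tabulate (sat .local s∈)))))))
      where
      somewhere : ∀ {s} → s ∈ S M → ⊩ ⋁ (map (λ t → var (E s t)) (filter (s ⟶?_) (allFin N)))
      somewhere {s} s∈ with t , s⟶t , e ← sat .serial s∈ =
        ⊩-⋁ _ _ .from (t , ∈-filter⁺ (s ⟶?_) (∈-allFin t) s⟶t , e)

  model-⊑ : model M 𝒱 ⊑ M
  model-⊑ = record
    { S⊆  = λ {t} t∈ → stays s₀∈S (∈-reachable (kept? M 𝒱) (s₀ M) t .to t∈)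
    ; s₀≡ = refl
    ; ⟶⊆  = λ (_ , _ , s⟶t , _) → s⟶t
    ; L↾  = λ _ _ → refl
    }
    where
    stays : ∀ {u v} → u ∈ S M → Star (Kept M 𝒱) u v → v ∈ S M
    stays u∈ ε                 = u∈
    stays u∈ ((u⟶v , _) ◅ v↝*) = stays (⟶-tgt u⟶v) v↝*

  -- A kept transition from a reachable state ends in a reachable state, so restricting the relation
  -- to `S (model M 𝒱)` removes none of them.
  model-kept : ∀ {s t} → s ∈ S (model M 𝒱) →
               Kripke._⟶_ (model M 𝒱) s t ⇔ (s ⟶ t × T (𝒱 (E s t)))
  model-kept {s} {t} s∈ = mk⇔
    (λ (_ , _ , s⟶t , e) → s⟶t , T-≡ .from e)
    (λ (s⟶t , e) → let st = s⟶t , T-≡ .to e in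
      s∈ , ∈-reachable (kept? M 𝒱) (s₀ M) t .from
             (∈-reachable (kept? M 𝒱) (s₀ M) s .to s∈ ◅◅ (st ◅ ε)) , st)

  model-total : SatisfiesRepair → Total (model M 𝒱)
  model-total sat s∈ with t , s⟶t,e ← sat .serial (model-⊑ ._⊑_.S⊆ s∈) =
    t , model-kept s∈ .from s⟶t,e

  repair-sound : SatisfiesRepair → model M 𝒱 , s₀ M ⊨ η
  repair-sound sat = correct η (λ χ∈ s∈ → sat .local s∈ χ∈) (Kripke.s₀∈S (model M 𝒱)) .to (sat .initial)
    where open Correctness M (model M 𝒱) model-⊑ (model-total sat) 𝒱 model-kept (sat .labels)

-- A satisfying assignment from a given repair

module _ (M K : Kripke k N) (K⊑M : K ⊑ M) where
  private
    module M = Kripke M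
    module K = Kripke K
  open _⊑_ K⊑M

  succs : Fin N → List (Fin N)
  succs s = filter (s M.⟶?_) (allFin N)

  -- Outside S K every transition of M is kept, so that all of S M stays serial.
  keepᵇ : Fin N → Fin N → Bool
  keepᵇ s t = not (does (s ∈? S K)) Bool.∨ does (s K.⟶? t)

  □ᵇ ◇ᵇ : (Fin N → Bool) → Fin N → Bool
  □ᵇ u s = all (λ t → not (keepᵇ s t) Bool.∨ u t) (succs s)
  ◇ᵇ u s = any (λ t → keepᵇ s t Bool.∧ u t) (succs s)

  releaseᵇ : ((Fin N → Bool) → Fin N → Bool) → (p q : Fin N → Bool) → ℕ → Fin N → Bool
  releaseᵇ ◯ p q zero    s = q s
  releaseᵇ ◯ p q (suc m) s = q s Bool.∧ (p s Bool.∨ ◯ (releaseᵇ ◯ p q m) s)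

  -- Evaluated outside K as well, because `repair` imposes its clauses on all states of M. The
  -- release cases take |S M| levels, as the clauses prescribe.
  truthᵇ : CTL k → Fin N → Bool
  truthᵇ (atom p)   s = M.L s p
  truthᵇ (~ φ)      s = not (truthᵇ φ s)
  truthᵇ (φ ∧ ψ)    s = truthᵇ φ s Bool.∧ truthᵇ ψ s
  truthᵇ (φ ∨ ψ)    s = truthᵇ φ s Bool.∨ truthᵇ ψ s
  truthᵇ (AX φ)     s = □ᵇ (truthᵇ φ) s
  truthᵇ (EX φ)     s = ◇ᵇ (truthᵇ φ) s
  truthᵇ A[ φ V ψ ] s = releaseᵇ □ᵇ (truthᵇ φ) (truthᵇ ψ) ∣ S M ∣ s
  truthᵇ E[ φ V ψ ] s = releaseᵇ ◇ᵇ (truthᵇ φ) (truthᵇ ψ) ∣ S M ∣ s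

  assignment : RepairVar k N → Bool
  assignment (E s t)             = keepᵇ s t
  assignment (X s ψ)             = truthᵇ ψ s
  assignment (Xᵐ m s A[ φ V ψ ]) = releaseᵇ □ᵇ (truthᵇ φ) (truthᵇ ψ) m s
  assignment (Xᵐ m s E[ φ V ψ ]) = releaseᵇ ◇ᵇ (truthᵇ φ) (truthᵇ ψ) m s
  -- A default value: `repair` has `Xᵐ` only at release formulas.
  assignment (Xᵐ _ _ _)          = false

  open Satisfaction assignment

  -- `truthᵇ` and `releaseᵇ` follow the recursion that the clauses state, so both sides have equal
  -- values at every state, in K or not.
  assignment-clauses : ∀ s ψ → All ⊩_ (clauses M s ψ)
  assignment-clauses s (atom p) = []
  assignment-clauses s (~ φ)    = ≡⇒⊩-⇔ (var (X s (~ φ))) (~ var (X s φ)) refl ∷ []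
  assignment-clauses s (φ ∧ ψ)  = ≡⇒⊩-⇔ (var (X s (φ ∧ ψ))) (var (X s φ) ∧ var (X s ψ)) refl ∷ []
  assignment-clauses s (φ ∨ ψ)  = ≡⇒⊩-⇔ (var (X s (φ ∨ ψ))) (var (X s φ) ∨ var (X s ψ)) refl ∷ []
  assignment-clauses s (AX φ)   =
    ≡⇒⊩-⇔ (var (X s (AX φ))) (⋀ (map (λ t → var (E s t) ⇒ var (X t φ)) (succs s)))
      (sym (eval-⋀ _ (succs s))) ∷ []
  assignment-clauses s (EX φ)   =
    ≡⇒⊩-⇔ (var (X s (EX φ))) (⋁ (map (λ t → var (E s t) ∧ var (X t φ)) (succs s)))
      (sym (eval-⋁ _ (succs s))) ∷ []
  assignment-clauses s ρ@(A[ φ V ψ ]) =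
    ≡⇒⊩-⇔ (var (X s ρ)) (var (Xᵐ ∣ S M ∣ s ρ)) refl ∷
    ≡⇒⊩-⇔ (var (Xᵐ 0 s ρ)) (var (X s ψ)) refl ∷
    All.map⁺ (All.tabulate λ {m} _ →
      ≡⇒⊩-⇔ (var (Xᵐ (suc m) s ρ))
        (var (X s ψ) ∧ (var (X s φ) ∨
          ⋀ (map (λ t → var (E s t) ⇒ var (Xᵐ m t ρ)) (succs s))))
        (cong (λ b → truthᵇ ψ s Bool.∧ (truthᵇ φ s Bool.∨ b))
          (sym (eval-⋀ _ (succs s)))))
  assignment-clauses s ρ@(E[ φ V ψ ]) =
    ≡⇒⊩-⇔ (var (X s ρ)) (var (Xᵐ ∣ S M ∣ s ρ)) refl ∷
    ≡⇒⊩-⇔ (var (Xᵐ 0 s ρ)) (var (X s ψ)) refl ∷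
    All.map⁺ (All.tabulate λ {m} _ →
      ≡⇒⊩-⇔ (var (Xᵐ (suc m) s ρ))
        (var (X s ψ) ∧ (var (X s φ) ∨
          ⋁ (map (λ t → var (E s t) ∧ var (Xᵐ m t ρ)) (succs s))))
        (cong (λ b → truthᵇ ψ s Bool.∧ (truthᵇ φ s Bool.∨ b))
          (sym (eval-⋁ _ (succs s)))))

  keepᵇ-⟶ : ∀ {s t} → s ∈ S K → (s K.⟶ t) ⇔ T (keepᵇ s t)
  keepᵇ-⟶ {s} {t} s∈ with s ∈? S K | s K.⟶? t
  ... | no s∉ | _       = contradiction s∈ s∉
  ... | yes _ | yes s⟶t = mk⇔ _ (λ _ → s⟶t)
  ... | yes _ | no s↛t  = mk⇔ s↛t λ ()

  -- States of K keep a successor by totality of K; the others keep all transitions, so totality of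
  -- M applies.
  assignment-serial : Total K → Total M → ∀ {s} → s ∈ S M → ∃[ t ] s M.⟶ t × T (keepᵇ s t)
  assignment-serial totalK totalM {s} s∈M with s ∈? S K in eq
  ... | yes s∈ with t , s⟶t ← totalK s∈ =
    -- `keepᵇ-⟶` speaks of the test `s ∈? S K`, the goal of its result `yes s∈`; `eq` connects them.
    t , ⟶⊆ s⟶t , subst (λ d → T (not (does d) Bool.∨ _)) eq (keepᵇ-⟶ s∈ .to s⟶t)
  ... | no _ with t , s⟶t ← totalM s∈M = t , s⟶t , _

  -- Clauses and labels hold by construction; X_{s_0,η} comes from `correct` at the initial state of
  -- K.
  assignment-satisfies : Total K → Total M → ∀ η → K , s₀ K ⊨ η →
                         SatisfiesRepair M η assignment
  assignment-satisfies totalK totalM η K⊨η = record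
    { initial = subst (λ s → T (truthᵇ η s)) s₀≡
        (correct η (λ {χ} _ {s} _ → assignment-clauses s χ) K.s₀∈S .from K⊨η)
    ; serial  = assignment-serial totalK totalM
    ; labels  = λ _ _ → T-≡
    ; local   = λ _ _ → assignment-clauses _ _
    }
    where
    open Correctness M K K⊑M totalK assignment
      (λ s∈ → mk⇔ (λ s⟶t → ⟶⊆ s⟶t , keepᵇ-⟶ s∈ .to s⟶t) (keepᵇ-⟶ s∈ .from ∘ proj₂))
      (λ _ _ → T-≡)

-- Correctness of the algorithm

⊑-refl : {M : Kripke k N} → M ⊑ M
⊑-refl = record { S⊆ = id ; s₀≡ = refl ; ⟶⊆ = id ; L↾ = λ _ _ → refl }

theorem3 : (k N : ℕ)
    (check : ModelChecker k N) (solve : SATSolver (RepairVar k N))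
    (M : Kripke k N) (total : Total M) (η : CTL k) →
    Repairable M η →
    ∃[ M″ ] ((Repair check solve M total η ≡ just M″) ×
    Total M″ × M″ ⊑ M × (M″ , s₀ M ⊨ η))
theorem3 k N check solve M total η (K , K⊑M , totalK , K⊨η) with check M total η
... | yes M⊨η = M , refl , total , ⊑-refl , M⊨η
... | no _ with solve (repair M η)
-- The assignment built from K refutes the answer "not satisfiable", so failure is impossible.
...   | no unsat = contradiction
        (assignment M K K⊑M , T-≡ .to
          (⊩-repair M η _ .from (assignment-satisfies M K K⊑M totalK total η K⊨η)))
        unsat
...   | yes (𝒱 , 𝒱⊩) =
  model M 𝒱 , refl , model-total M η 𝒱 sat , model-⊑ M η 𝒱 , repair-sound M η 𝒱 sat
  where sat = ⊩-repair M η 𝒱 .to (T-≡ .from 𝒱⊩)
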